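{- Let $n\geq 3$ and let $\Gamma=(V,E)$ be a cubic graph. If there exists an $e'\in E$ such that $\Gamma\setminus e'$ (the graph obtained by deleting $e'$) has a nowhere-zero $n$-flow, then $\Gamma$ has a nowhere-identity dihedral $n$-flow for any embedding for which $e'$ is contained in a simple contractible cycle.
   Context: Graphs are finite and may have loops and parallel edges; $\Gamma$ is connected; cubic means every vertex has degree $3$. An embedding of $\Gamma=(V,E)$ is given by a rotation system $\pi=\{\pi_v\mid v\in V\}$, where $\pi_v$ is a cyclic order of the edges incident with $v$ (a loop appears twice); equivalently, it is a cellular embedding in a closed connected orientable surface $S$. A simple contractible cycle is a cycle of $\Gamma$ without repeated vertices that, viewed as a closed curve in $S$, is homotopic to a constant map (equivalently, it bounds a disk in $S$). For a group $G$ and an orientation of the edges, a $G$-flow is a map $f:E\to G$ such that at each vertex $v$ the product of the values of the incident edges, taken in the order $\pi_v$, is the identity, where the inverse $f(e)^{ -1}$ is used for an edge leaving $v$. It is nowhere-identity if $f(e)\neq1$ for all $e$. Existence does not depend on the orientation. $\mathbb{D}=\{\begin{pmatrix}\pm1&a\\0&1\end{pmatrix}\mid a\in\mathbb{Z}\}$ and $\mathbb{D}^{<n}=\{\begin{pmatrix}\pm1&a\\0&1\end{pmatrix}\in\mathbb{D}\mid |a|<n\}$. A nowhere-identity dihedral $n$-flow is a nowhere-identity $\mathbb{D}$-flow with all values in $\mathbb{D}^{<n}$. A nowhere-zero $n$-flow on a graph is a $\mathbb{Z}$-flow (Kirchhoff's law with respect to some orientation) with values in $\{\pm1,\dots,\pm(n-1)\}$.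 -}

module Defs where

open import Algebra.Bundles using (Group; AbelianGroup)
open import Data.Bool.Base using (Bool; true; false; not; if_then_else_)
import Data.Bool.Properties as Bool
open import Data.Fin.Base using (Fin; punchIn)
import Data.Fin.Properties as Fin
open import Data.Integer.Base using (ℤ; 0ℤ; -_; ∣_∣) renaming (_+_ to _+ℤ_)
import Data.Integer.Properties as ℤ
open import Data.List.Base using (List; []; _∷_; _++_; map; filter; foldr; iterate; length; allFin; cartesianProduct)
open import Data.List.Membership.Propositional using (_∈_)
open import Data.List.Relation.Unary.Unique.Propositional using (Unique)
open import Data.Nat.Base using (ℕ; suc; pred; _<_)
import Data.Nat.GeneralisedArithmetic as Iterate
open import Data.Product.Base using (Σ; ∃; ∃₂; _×_; _,_; proj₁)
open import Data.Sign.Base using (Sign) renaming (+ to pos; - to neg; _*_ to _*S_)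
import Data.Sign.Properties as Sign
open import Function.Bundles using (_↔_; Inverse)
open import Level using (0ℓ)
open import Relation.Binary.Construct.Closure.Equivalence using (EqClosure)
open import Relation.Binary.Core using (Rel)
open import Relation.Binary.PropositionalEquality
  using (_≡_; _≢_; refl; sym; cong; cong₂; isEquivalence; module ≡-Reasoning)
open import Relation.Nullary.Decidable using (does)

-- Every edge e consists of two half-edges (darts), (e , true) and (e , false).
-- A dart also stands for e traversed starting from that half-edge.

Dart : ℕ → Set
Dart ne = Fin ne × Bool

edge : ∀ {ne} → Dart ne → Fin ne
edge = proj₁

rev : ∀ {ne} → Dart ne → Dart ne
rev (e , b) = e , not b

-- Since src is arbitrary, loops and parallel edges are allowed; a loop
-- contributes two distinct darts at its vertex.

record Graph (nv ne : ℕ) : Set where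
  field
    src : Dart ne → Fin nv

  tgt : Dart ne → Fin nv
  tgt d = src (rev d)

  dartsAt : Fin nv → List (Dart ne)
  dartsAt v = filter (λ d → src d Fin.≟ v)
                     (cartesianProduct (allFin ne) (true ∷ false ∷ []))

  degree : Fin nv → ℕ
  degree v = length (dartsAt v)

  IsWalk : Fin nv → List (Dart ne) → Fin nv → Set
  IsWalk u []       v = u ≡ v
  IsWalk u (d ∷ ds) v = src d ≡ u × IsWalk (tgt d) ds v

  Connected : Set
  Connected = ∀ u v → ∃ λ ds → IsWalk u ds v

  Cubic : Set
  Cubic = ∀ v → degree v ≡ 3

  -- Distinctness of the edges only matters for closed walks of length 2, where
  -- it rules out traversing one edge back and forth.  A loop is a cycle of length 1.
  record IsSimpleCycle (u : Fin nv) (C : List (Dart ne)) : Set where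
    field
      closed           : IsWalk u C u
      nonempty         : C ≢ []
      distinctVertices : Unique (map src C)
      distinctEdges    : Unique (map edge C)

delete : ∀ {nv ne} → Graph nv ne → Fin ne → Graph nv (pred ne)
delete {ne = suc _} Γ e′ = record { src = λ (e , b) → Graph.src Γ (punchIn e′ e , b) }

-- next d is the successor of d in the cyclic order at the vertex src d.  By
-- `cyclic`, the darts at each vertex form a single cycle of the permutation.

record RotationSystem {nv ne} (Γ : Graph nv ne) : Set where
  open Graph Γ
  field
    rotation : Dart ne ↔ Dart ne

  next : Dart ne → Dart ne
  next = Inverse.to rotation

  field
    src-next : ∀ d → src (next d) ≡ src d
    cyclic   : ∀ d d′ → src d ≡ src d′ → ∃ λ k → Iterate.iterate next d k ≡ d′

  -- The darts at the vertex of d in rotation order, each once, starting with d.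
  around : Dart ne → List (Dart ne)
  around d = iterate next d (degree (src d))

  -- The dart following d on the boundary of the face on one fixed side of d.
  faceNext : Dart ne → Dart ne
  faceNext d = next (rev d)

  IsFacialWalk : List (Dart ne) → Set
  IsFacialWalk ds = ∃₂ λ d k →
    ds ≡ iterate faceNext d (suc k) × Iterate.iterate faceNext d (suc k) ≡ d × Unique ds

  -- The surface is the 2-complex obtained from Γ by gluing a disk along every
  -- facial walk.  Closed walks at u are homotopic in it (relative to u) exactly
  -- when they are connected by insertions and deletions of spurs and of facial
  -- walks.  For closed curves, free and based homotopy to a constant agree.

  data Reduces : Rel (List (Dart ne)) 0ℓ where
    spur : ∀ xs d ys → Reduces (xs ++ d ∷ rev d ∷ ys) (xs ++ ys)
    face : ∀ xs {ds} ys → IsFacialWalk ds → Reduces (xs ++ ds ++ ys) (xs ++ ys)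

  Homotopic : Fin nv → Rel (List (Dart ne)) 0ℓ
  Homotopic u = EqClosure (λ xs ys → IsWalk u xs u × IsWalk u ys u × Reduces xs ys)

  Contractible : Fin nv → List (Dart ne) → Set
  Contractible u C = Homotopic u C []

  OnSimpleContractibleCycle : Fin ne → Set
  OnSimpleContractibleCycle e = ∃₂ λ u C →
    IsSimpleCycle u C × Contractible u C × e ∈ map edge C

-- o e = b means that e is directed away from the vertex of (e , b), towards
-- the vertex of (e , not b).

Orientation : ℕ → Set
Orientation ne = Fin ne → Bool

module _ {c ℓ} (G : Group c ℓ) where
  open Group G

  product : List Carrier → Carrier
  product = foldr _∙_ ε

  dartValue : ∀ {ne} → Orientation ne → (Fin ne → Carrier) → Dart ne → Carrier
  dartValue o f (e , b) = if does (b Bool.≟ o e) then f e ⁻¹ else f e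

  -- The starting point d in the cyclic order at src d is arbitrary.
  IsFlow : ∀ {nv ne} {Γ : Graph nv ne} → RotationSystem Γ →
           Orientation ne → (Fin ne → Carrier) → Set ℓ
  IsFlow π o f = ∀ d → product (map (dartValue o f) (RotationSystem.around π d)) ≈ ε

ℤ-group : Group 0ℓ 0ℓ
ℤ-group = AbelianGroup.group ℤ.+-0-abelianGroup

-- In the abelian group ℤ the order of the incident darts is irrelevant, so no
-- rotation system is involved.

SatisfiesKirchhoff : ∀ {nv ne} → Graph nv ne → Orientation ne → (Fin ne → ℤ) → Set
SatisfiesKirchhoff Γ o f = ∀ v →
  product ℤ-group (map (dartValue ℤ-group o f) (Graph.dartsAt Γ v)) ≡ 0ℤ

HasNowhereZeroFlow : ∀ {nv ne} → ℕ → Graph nv ne → Set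
HasNowhereZeroFlow {ne = ne} n Γ =
  Σ (Orientation ne) λ o → Σ (Fin ne → ℤ) λ f →
    SatisfiesKirchhoff Γ o f × (∀ e → f e ≢ 0ℤ × ∣ f e ∣ < n)

-- mk𝔻 s a is the matrix with rows (s , a) and (0 , 1), where s = ±1.

record 𝔻 : Set where
  constructor mk𝔻
  field
    sign  : Sign
    shift : ℤ

infixr 8 _·_
_·_ : Sign → ℤ → ℤ
pos · a = a
neg · a = - a

infixl 7 _∙𝔻_
_∙𝔻_ : 𝔻 → 𝔻 → 𝔻
mk𝔻 s a ∙𝔻 mk𝔻 t b = mk𝔻 (s *S t) (s · b +ℤ a)

1𝔻 : 𝔻
1𝔻 = mk𝔻 pos 0ℤ

_⁻¹𝔻 : 𝔻 → 𝔻
mk𝔻 s a ⁻¹𝔻 = mk𝔻 s (s · (- a))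

private
  ·-+ : ∀ s a b → s · (a +ℤ b) ≡ s · a +ℤ s · b
  ·-+ pos a b = refl
  ·-+ neg a b = ℤ.neg-distrib-+ a b

  ·-* : ∀ s t a → (s *S t) · a ≡ s · (t · a)
  ·-* pos t   a = refl
  ·-* neg pos a = refl
  ·-* neg neg a = sym (ℤ.neg-involutive a)

  ∙𝔻-assoc : ∀ x y z → (x ∙𝔻 y) ∙𝔻 z ≡ x ∙𝔻 (y ∙𝔻 z)
  ∙𝔻-assoc (mk𝔻 s a) (mk𝔻 t b) (mk𝔻 u c) = cong₂ mk𝔻 (Sign.*-assoc s t u) (begin
    (s *S t) · c +ℤ (s · b +ℤ a)  ≡⟨ cong (_+ℤ (s · b +ℤ a)) (·-* s t c) ⟩
    s · (t · c) +ℤ (s · b +ℤ a)   ≡⟨ ℤ.+-assoc (s · (t · c)) (s · b) a ⟨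
    s · (t · c) +ℤ s · b +ℤ a     ≡⟨ cong (_+ℤ a) (·-+ s (t · c) b) ⟨
    s · (t · c +ℤ b) +ℤ a         ∎)
    where open ≡-Reasoning

  ∙𝔻-identityˡ : ∀ x → 1𝔻 ∙𝔻 x ≡ x
  ∙𝔻-identityˡ (mk𝔻 s a) = cong (mk𝔻 s) (ℤ.+-identityʳ a)

  ∙𝔻-identityʳ : ∀ x → x ∙𝔻 1𝔻 ≡ x
  ∙𝔻-identityʳ (mk𝔻 pos a) = cong (mk𝔻 pos) (ℤ.+-identityˡ a)
  ∙𝔻-identityʳ (mk𝔻 neg a) = cong (mk𝔻 neg) (ℤ.+-identityˡ a)

  ∙𝔻-inverseˡ : ∀ x → (x ⁻¹𝔻) ∙𝔻 x ≡ 1𝔻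
  ∙𝔻-inverseˡ (mk𝔻 pos a) = cong (mk𝔻 pos) (ℤ.+-inverseʳ a)
  ∙𝔻-inverseˡ (mk𝔻 neg a) = cong (mk𝔻 pos) (ℤ.+-inverseʳ (- a))

  ∙𝔻-inverseʳ : ∀ x → x ∙𝔻 (x ⁻¹𝔻) ≡ 1𝔻
  ∙𝔻-inverseʳ (mk𝔻 pos a) = cong (mk𝔻 pos) (ℤ.+-inverseˡ a)
  ∙𝔻-inverseʳ (mk𝔻 neg a) = cong (mk𝔻 pos) (begin
    - (- (- a)) +ℤ a  ≡⟨ cong (_+ℤ a) (ℤ.neg-involutive (- a)) ⟩
    - a +ℤ a          ≡⟨ ℤ.+-inverseˡ a ⟩
    0ℤ                ∎)
    where open ≡-Reasoning

𝔻-group : Group 0ℓ 0ℓ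
𝔻-group = record
  { Carrier = 𝔻
  ; _≈_     = _≡_
  ; _∙_     = _∙𝔻_
  ; ε       = 1𝔻
  ; _⁻¹     = _⁻¹𝔻
  ; isGroup = record
    { isMonoid = record
      { isSemigroup = record
        { isMagma = record { isEquivalence = isEquivalence ; ∙-cong = cong₂ _∙𝔻_ }
        ; assoc   = ∙𝔻-assoc
        }
      ; identity = ∙𝔻-identityˡ , ∙𝔻-identityʳ
      }
    ; inverse = ∙𝔻-inverseˡ , ∙𝔻-inverseʳ
    ; ⁻¹-cong = cong _⁻¹𝔻
    }
  }

HasNowhereIdentityDihedralFlow :
  ∀ {nv ne} {Γ : Graph nv ne} → ℕ → RotationSystem Γ → Orientation ne → Set
HasNowhereIdentityDihedralFlow {ne = ne} n π o =
  Σ (Fin ne → 𝔻) λ f →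
    IsFlow 𝔻-group π o f × (∀ e → f e ≢ 1𝔻 × ∣ 𝔻.shift (f e) ∣ < n)

{-# OPTIONS --safe #-}

-- A contractible cycle C is null-homologous mod 2, so the faces can be signed in
-- such a way that the sign changes exactly across the edges of C.  Write h d for
-- the sign of the face of the dart d, and ψ d for the value entering the source
-- of d along d in the flow on Γ ∖ e′, extended by 0 to e′.  Put
-- g d = (h d * h (rev d) , h d · ψ d): the edges of C become reflections, and the
-- flow is negated on one side of C.  Since h (next d) = h (rev d), the product of
-- the values of g around a vertex telescopes to (1 , h d · Σ ψ), which is the
-- identity by Kirchhoff's law, and g is not the identity on e′ because it is a
-- reflection there.

module Submission where

open import Defs
open import Algebra.Bundles using (Group)
import Algebra.Properties.CommutativeSemigroup as CommutativeSemigroupProperties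
import Algebra.Properties.Group as GroupProperties
open import Data.Bool.Base using (Bool; true; false; not; if_then_else_)
import Data.Bool.Properties as Bool
open import Data.Fin.Base using (Fin; punchIn; punchOut)
import Data.Fin.Properties as Fin
open import Data.Integer.Base using (ℤ; 0ℤ; -_; ∣_∣) renaming (_+_ to _+ℤ_)
import Data.Integer.Properties as ℤ
open import Data.List.Base using (List; []; _∷_; _++_; _∷ʳ_; [_]; map; filter; iterate; allFin; cartesianProduct)
open import Data.List.Membership.Propositional using (_∈_; _∉_)
open import Data.List.Membership.Propositional.Properties
  using (∈-++⁺ˡ; ∈-++⁻; ∈-map⁺; ∈-map⁻; ∈-filter⁺; ∈-filter⁻; ∈-allFin; ∈-cartesianProduct⁺)
open import Data.List.Membership.Propositional.Properties.WithK using (unique∧set⇒bag)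
open import Data.List.Properties using (length-iterate; map-∘; map-cong; map-++)
open import Data.List.Relation.Binary.BagAndSetEquality using (∼bag⇒↭)
open import Data.List.Relation.Binary.Permutation.Propositional using (_↭_; ↭⇒↭ₛ)
open import Data.List.Relation.Binary.Permutation.Propositional.Properties using (↭-length) renaming (map⁺ to ↭-map⁺)
open import Data.List.Relation.Binary.Permutation.Setoid.Properties using (foldr-commMonoid)
open import Data.List.Relation.Unary.All using ([]; _∷_)
open import Data.List.Relation.Unary.All.Properties using (¬Any⇒All¬; All¬⇒¬Any)
open import Data.List.Relation.Unary.Any using (here; there)
open import Data.List.Relation.Unary.AllPairs using ([]; _∷_)
open import Data.List.Relation.Unary.Unique.Propositional using (Unique)
import Data.List.Relation.Unary.Unique.Propositional.Properties as Unique
open import Data.Nat.Base using (ℕ; zero; suc; _≤_; _<_; s≤s; z≤n)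
import Data.Nat.GeneralisedArithmetic as Iterate
import Data.Nat.Properties as ℕ
open import Data.Product.Base using (∃; _×_; _,_; proj₁; proj₂)
open import Data.Product.Properties using (≡-dec)
open import Data.Sign.Base using (Sign) renaming (+ to pos; - to neg; _*_ to _*S_)
import Data.Sign.Properties as Sign
open import Data.Sum.Base using (inj₁; inj₂)
import Data.Vec.Functional as Vector
open import Data.Vec.Functional.Properties using (insertAt-lookup; insertAt-punchIn)
open import Function.Base using (_∘_; case_of_)
open import Function.Bundles using (mk⇔; module Injection)
open import Function.Definitions using (Injective)
open import Function.Properties.Inverse using (↔⇒↣)
import Relation.Binary.Construct.Closure.Equivalence as EqClosure
open import Relation.Binary.Definitions using (DecidableEquality)
open import Relation.Binary.Core using (Rel)
open import Relation.Binary.Structures using (IsEquivalence)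
open import Relation.Binary.PropositionalEquality
  using (_≡_; _≢_; refl; sym; trans; cong; cong₂; subst; setoid; module ≡-Reasoning)
open import Relation.Nullary.Decidable using (Dec; yes; no; does; ¬?; dec-true; dec-false)
open import Relation.Nullary.Negation using (¬_; contradiction)
open import Level using (0ℓ)

open CommutativeSemigroupProperties Sign.*-commutativeSemigroup using (interchange)

unique∧set⇒↭ : ∀ {a} {A : Set a} {xs ys : List A} → Unique xs → Unique ys →
               (∀ {x} → x ∈ xs → x ∈ ys) → (∀ {x} → x ∈ ys → x ∈ xs) → xs ↭ ys
unique∧set⇒↭ xs! ys! xs⊆ys ys⊆xs = ∼bag⇒↭ (unique∧set⇒bag xs! ys! (mk⇔ xs⊆ys ys⊆xs))

-- Orbits of an injective map

module _ {a} {A : Set a} (f : A → A) where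

  iterate-∷ʳ : ∀ x n → iterate f x (suc n) ≡ iterate f x n ∷ʳ Iterate.iterate f x n
  iterate-∷ʳ x zero    = refl
  iterate-∷ʳ x (suc n) = cong (x ∷_) (iterate-∷ʳ (f x) n)

  iterate-map : ∀ x n → iterate f (f x) n ≡ map f (iterate f x n)
  iterate-map x zero    = refl
  iterate-map x (suc n) = cong (f x ∷_) (iterate-map (f x) n)

  -- Mapping `f` over the list drops its first term and appends one new term, which is `x` again.
  ∈-iterate-closed : ∀ {x y} n → Iterate.iterate f x (suc n) ≡ x →
                     y ∈ iterate f x (suc n) → f y ∈ iterate f x (suc n)
  ∈-iterate-closed {x} {y} n fˢⁿx≡x y∈ with ∈-++⁻ (iterate f x (suc n)) fy∈
    where
    fy∈ : f y ∈ iterate f x (suc n) ∷ʳ Iterate.iterate f x (suc n)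
    fy∈ = subst (f y ∈_) (iterate-∷ʳ x (suc n))
            (there (subst (f y ∈_) (sym (iterate-map x (suc n))) (∈-map⁺ f y∈)))
  ... | inj₁ fy∈         = fy∈
  ... | inj₂ (here fy≡) = here (trans fy≡ fˢⁿx≡x)

  iterate-∈ : ∀ {x y} n k → Iterate.iterate f x (suc n) ≡ x →
              y ∈ iterate f x (suc n) → Iterate.iterate f y k ∈ iterate f x (suc n)
  iterate-∈ n zero    fˢⁿx≡x y∈ = y∈
  iterate-∈ n (suc k) fˢⁿx≡x y∈ = iterate-∈ n k fˢⁿx≡x (∈-iterate-closed n fˢⁿx≡x y∈)

  -- A return time supplied by `cyclic` may run around the vertex several times; stopping at the
  -- first visit yields an orbit without repetition.
  firstVisit : DecidableEquality A → ∀ {x} y n → Iterate.iterate f y n ≡ x →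
               ∃ λ m → Iterate.iterate f y m ≡ x × x ∉ iterate f y m
  firstVisit _≟_ {x} y n fⁿy≡x with y ≟ x
  ... | yes y≡x = zero , y≡x , λ ()
  firstVisit _≟_ y zero    fⁿy≡x | no y≢x = contradiction fⁿy≡x y≢x
  firstVisit _≟_ y (suc n) fⁿy≡x | no y≢x =
    let m , fᵐ , x∉ = firstVisit _≟_ (f y) n fⁿy≡x
    in  suc m , fᵐ , λ { (here x≡y) → y≢x (sym x≡y) ; (there x∈) → x∉ x∈ }

  module _ (f-injective : Injective _≡_ _≡_ f) where

    -- By injectivity, a recurrence of `f x` pulls back along `f` to a recurrence of `x`, which is
    -- excluded.
    unique-iterate : ∀ x n → x ∉ iterate f (f x) n → Unique (iterate f x (suc n))
    unique-iterate x zero    x∉ = [] ∷ []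
    unique-iterate x (suc n) x∉ = ¬Any⇒All¬ _ x∉ ∷ unique-iterate (f x) n λ fx∈ →
      let y , y∈ , fx≡fy = ∈-map⁻ f (subst (f x ∈_) (iterate-map (f x) n) fx∈)
      in  x∉ (subst (x ∈_) (sym (iterate-∷ʳ (f x) n))
               (∈-++⁺ˡ (subst (_∈ iterate f (f x) n) (sym (f-injective fx≡fy)) y∈)))

-- Counting occurrences modulo 2

module _ {a} {A : Set a} (_≟_ : DecidableEquality A) where

  -- `Sign` serves as the integers modulo 2 in multiplicative notation, with `neg` for odd.
  indicator : A → A → Sign
  indicator x y = if does (x ≟ y) then neg else pos

  parity : A → List A → Sign
  parity x ys = product Sign.*-group (map (indicator x) ys)

  parity-++ : ∀ x ys zs → parity x (ys ++ zs) ≡ parity x ys *S parity x zs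
  parity-++ x []       zs = refl
  parity-++ x (y ∷ ys) zs = trans (cong (indicator x y *S_) (parity-++ x ys zs))
                                  (sym (Sign.*-assoc (indicator x y) _ _))

  ∉⇒parity≡pos : ∀ {x ys} → x ∉ ys → parity x ys ≡ pos
  ∉⇒parity≡pos {x} {[]}     x∉ = refl
  ∉⇒parity≡pos {x} {y ∷ ys} x∉ rewrite dec-false (x ≟ y) (x∉ ∘ here) = ∉⇒parity≡pos (x∉ ∘ there)

  ∈∧unique⇒parity≡neg : ∀ {x ys} → x ∈ ys → Unique ys → parity x ys ≡ neg
  ∈∧unique⇒parity≡neg {x} (here refl) (x# ∷ ys!)
    rewrite dec-true (x ≟ x) refl | ∉⇒parity≡pos (All¬⇒¬Any x#) = refl
  ∈∧unique⇒parity≡neg {x} {y ∷ ys} (there x∈) (y# ∷ ys!)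
    rewrite dec-false (x ≟ y) (λ { refl → All¬⇒¬Any y# x∈ }) = ∈∧unique⇒parity≡neg x∈ ys!

  module _ {f : A → A} (f-injective : Injective _≡_ _≡_ f) where

    indicator-injective : ∀ x y → indicator (f x) (f y) ≡ indicator x y
    indicator-injective x y with x ≟ y
    ... | yes x≡y rewrite dec-true (f x ≟ f y) (cong f x≡y) = refl
    ... | no  x≢y rewrite dec-false (f x ≟ f y) (x≢y ∘ f-injective) = refl

    parity-map : ∀ x ys → parity (f x) (map f ys) ≡ parity x ys
    parity-map x []       = refl
    parity-map x (y ∷ ys) = cong₂ _*S_ (indicator-injective x y) (parity-map x ys)

    -- Count `f x` in the list of `suc n` iterates starting at `y`. Without its first term this list
    -- is `map f ys`, and without its last it is `ys`; both removed terms are `y` because the orbit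
    -- closes.
    parity-orbit : ∀ y n → Iterate.iterate f y n ≡ y →
                   ∀ x → parity (f x) (iterate f y n) ≡ parity x (iterate f y n)
    parity-orbit y n fⁿy≡y x = sym (Sign.*-cancelˡ-≡ i _ _ (begin
      i *S parity x ys                     ≡⟨ cong (i *S_) (parity-map x ys) ⟨
      i *S parity (f x) (map f ys)         ≡⟨ cong (λ zs → i *S parity (f x) zs) (iterate-map f y n) ⟨
      parity (f x) (iterate f y (suc n))   ≡⟨ cong (parity (f x)) (iterate-∷ʳ f y n) ⟩
      parity (f x) (ys ∷ʳ Iterate.iterate f y n)
                                           ≡⟨ cong (λ z → parity (f x) (ys ∷ʳ z)) fⁿy≡y ⟩
      parity (f x) (ys ∷ʳ y)               ≡⟨ parity-++ (f x) ys [ y ] ⟩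
      parity (f x) ys *S (i *S pos)        ≡⟨ cong (parity (f x) ys *S_) (Sign.*-identityʳ i) ⟩
      parity (f x) ys *S i                 ≡⟨ Sign.*-comm (parity (f x) ys) i ⟩
      i *S parity (f x) ys                 ∎))
      where
      open ≡-Reasoning
      ys = iterate f y n
      i = indicator (f x) y

-- Darts and their values

rev-involutive : ∀ {ne} (d : Dart ne) → rev (rev d) ≡ d
rev-involutive (e , b) = cong (e ,_) (Bool.not-involutive b)

rev-injective : ∀ {ne} → Injective _≡_ _≡_ (rev {ne})
rev-injective {x = d} {y = d′} eq = trans (sym (rev-involutive d)) (trans (cong rev eq) (rev-involutive d′))

_≟ᵈ_ : ∀ {ne} → DecidableEquality (Dart ne)
_≟ᵈ_ = ≡-dec Fin._≟_ Bool._≟_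

edgeParity : ∀ {ne} → Fin ne → List (Dart ne) → Sign
edgeParity e ds = parity Fin._≟_ e (map edge ds)

edgeParity-++ : ∀ {ne} (e : Fin ne) ds ds′ → edgeParity e (ds ++ ds′) ≡ edgeParity e ds *S edgeParity e ds′
edgeParity-++ e ds ds′ = trans (cong (parity Fin._≟_ e) (map-++ edge ds ds′)) (parity-++ Fin._≟_ e (map edge ds) _)

-- The contributions of `xs` and `ys` occur twice on the right and cancel modulo 2.
edgeParity-remove : ∀ {ne} (e : Fin ne) xs ds ys →
  edgeParity e ds ≡ edgeParity e (xs ++ ds ++ ys) *S edgeParity e (xs ++ ys)
edgeParity-remove e xs ds ys
  rewrite edgeParity-++ e xs (ds ++ ys) | edgeParity-++ e ds ys | edgeParity-++ e xs ys
  = cancel (edgeParity e xs) (edgeParity e ds) (edgeParity e ys)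
  where
  cancel : ∀ x d y → d ≡ (x *S (d *S y)) *S (x *S y)
  cancel pos pos pos = refl
  cancel pos pos neg = refl
  cancel pos neg pos = refl
  cancel pos neg neg = refl
  cancel neg pos pos = refl
  cancel neg pos neg = refl
  cancel neg neg pos = refl
  cancel neg neg neg = refl

-- If the edges agree, exactly one of `d` and `rev d` is `d′`; otherwise neither is.
indicator-edge : ∀ {ne} (d d′ : Dart ne) →
  indicator Fin._≟_ (edge d) (edge d′) ≡ indicator _≟ᵈ_ d d′ *S indicator _≟ᵈ_ (rev d) d′
indicator-edge (e , b) (e′ , b′) with e Fin.≟ e′
indicator-edge (e , b)     (e′ , b′)    | no  _    = refl
indicator-edge (e , true)  (_ , true)  | yes refl = refl
indicator-edge (e , true)  (_ , false) | yes refl = refl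
indicator-edge (e , false) (_ , true)  | yes refl = refl
indicator-edge (e , false) (_ , false) | yes refl = refl

edgeParity-darts : ∀ {ne} (d : Dart ne) ds →
  edgeParity (edge d) ds ≡ parity _≟ᵈ_ d ds *S parity _≟ᵈ_ (rev d) ds
edgeParity-darts d []        = refl
edgeParity-darts d (d′ ∷ ds) = trans
  (cong₂ _*S_ (indicator-edge d d′) (edgeParity-darts d ds))
  (interchange (indicator _≟ᵈ_ d d′) _ _ _)

module _ {c ℓ} (G : Group c ℓ) where
  open Group G using (Carrier; _≈_; _⁻¹; ε) renaming (sym to ≈-sym; refl to ≈-refl)

  dartValue-rev : ∀ {ne} (o : Orientation ne) f d →
                  dartValue G o f (rev d) ≈ dartValue G o f d ⁻¹
  dartValue-rev o f (e , b) with o e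
  dartValue-rev o f (e , true)  | true  = ≈-sym (GroupProperties.⁻¹-involutive G (f e))
  dartValue-rev o f (e , true)  | false = ≈-refl
  dartValue-rev o f (e , false) | true  = ≈-refl
  dartValue-rev o f (e , false) | false = ≈-sym (GroupProperties.⁻¹-involutive G (f e))

  -- The value of `e` is read off at the dart at its head, where `dartValue` does not invert; the
  -- hypothesis on `rev` settles the other dart. Thus one function on darts serves every
  -- orientation.
  dartValue-fromDarts : ∀ {ne} (o : Orientation ne) (g : Dart ne → Carrier) →
    (∀ d → g (rev d) ≈ g d ⁻¹) →
    ∀ d → dartValue G o (λ e → g (e , not (o e))) d ≈ g d
  dartValue-fromDarts o g g-rev (e , b) with o e
  dartValue-fromDarts o g g-rev (e , true)  | true  = ≈-sym (g-rev (e , false))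
  dartValue-fromDarts o g g-rev (e , true)  | false = ≈-refl
  dartValue-fromDarts o g g-rev (e , false) | true  = ≈-refl
  dartValue-fromDarts o g g-rev (e , false) | false = ≈-sym (g-rev (e , true))

∣dartValue∣ : ∀ {ne} (o : Orientation ne) f d → ∣ dartValue ℤ-group o f d ∣ ≡ ∣ f (edge d) ∣
∣dartValue∣ o f (e , b) with does (b Bool.≟ o e)
... | true  = ℤ.∣-i∣≡∣i∣ (f e)
... | false = refl

product-map-↭ : ∀ {ne} (ψ : Dart ne → ℤ) {ds ds′} → ds ↭ ds′ →
                product ℤ-group (map ψ ds) ≡ product ℤ-group (map ψ ds′)
product-map-↭ ψ ds↭ds′ = foldr-commMonoid (setoid ℤ) ℤ.+-0-isCommutativeMonoid (↭⇒↭ₛ (↭-map⁺ ψ ds↭ds′))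

product-map-filter : ∀ {a p} {A : Set a} {P : A → Set p} (P? : ∀ x → Dec (P x)) (ψ : A → ℤ) →
  (∀ x → ¬ P x → ψ x ≡ 0ℤ) →
  ∀ xs → product ℤ-group (map ψ (filter P? xs)) ≡ product ℤ-group (map ψ xs)
product-map-filter P? ψ vanishes []       = refl
product-map-filter P? ψ vanishes (x ∷ xs) with P? x
... | yes _   = cong (ψ x +ℤ_) (product-map-filter P? ψ vanishes xs)
... | no  ¬Px = trans (product-map-filter P? ψ vanishes xs)
                      (sym (trans (cong (_+ℤ product ℤ-group (map ψ xs)) (vanishes x ¬Px)) (ℤ.+-identityˡ _)))

-- Enumerating the darts at a vertex

module _ {nv ne} (Γ : Graph nv ne) where
  open Graph Γ

  dartsAt-unique : ∀ v → Unique (dartsAt v)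
  dartsAt-unique v = Unique.filter⁺ (λ d → src d Fin.≟ v)
    (Unique.cartesianProduct⁺ (Unique.allFin⁺ ne) (((λ ()) ∷ []) ∷ [] ∷ []))

  ∈-dartsAt⁺ : ∀ {v} d → src d ≡ v → d ∈ dartsAt v
  ∈-dartsAt⁺ {v} (e , b) = ∈-filter⁺ (λ d → src d Fin.≟ v) (∈-cartesianProduct⁺ (∈-allFin e) (∈-bools b))
    where
    ∈-bools : ∀ b → b ∈ true ∷ false ∷ []
    ∈-bools true  = here refl
    ∈-bools false = there (here refl)

  ∈-dartsAt⁻ : ∀ {v d} → d ∈ dartsAt v → src d ≡ v
  ∈-dartsAt⁻ {v} = proj₂ ∘ ∈-filter⁻ (λ d → src d Fin.≟ v) {xs = cartesianProduct (allFin ne) _}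

-- Extending a flow on Γ ∖ e′ by zero

module _ {nv ne} (Γ : Graph nv (suc ne)) (e′ : Fin (suc ne)) where
  open Graph Γ

  private
    _≢e′? : (d : Dart (suc ne)) → Dec (edge d ≢ e′)
    d ≢e′? = ¬? (edge d Fin.≟ e′)

    embed : Dart ne → Dart (suc ne)
    embed (e , b) = punchIn e′ e , b

    embed-injective : Injective _≡_ _≡_ embed
    embed-injective {e₁ , b₁} {e₂ , b₂} eq =
      cong₂ _,_ (Fin.punchIn-injective e′ e₁ e₂ (cong proj₁ eq)) (cong proj₂ eq)

  -- A permutation suffices for sums in `ℤ`. Neither list has repetitions, so only membership is
  -- compared, `punchOut` inverting `punchIn` on the edges other than `e′`.
  dartsAt-delete : ∀ v → filter _≢e′? (dartsAt v) ↭ map embed (Graph.dartsAt (delete Γ e′) v)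
  dartsAt-delete v = unique∧set⇒↭
    (Unique.filter⁺ _≢e′? (dartsAt-unique Γ v))
    (Unique.map⁺ embed-injective (dartsAt-unique (delete Γ e′) v))
    to from
    where
    to : ∀ {d} → d ∈ filter _≢e′? (dartsAt v) → d ∈ map embed (Graph.dartsAt (delete Γ e′) v)
    to {e , b} d∈ =
      let d∈v , e≢e′ = ∈-filter⁻ _≢e′? {xs = dartsAt v} d∈
          d≡ : embed (punchOut (e≢e′ ∘ sym) , b) ≡ (e , b)
          d≡ = cong (_, b) (Fin.punchIn-punchOut (e≢e′ ∘ sym))
      in  subst (_∈ _) d≡ (∈-map⁺ embed
            (∈-dartsAt⁺ (delete Γ e′) _ (trans (cong src d≡) (∈-dartsAt⁻ Γ d∈v))))

    from : ∀ {d} → d ∈ map embed (Graph.dartsAt (delete Γ e′) v) → d ∈ filter _≢e′? (dartsAt v)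
    from d∈ with ∈-map⁻ embed d∈
    ... | (e , b) , d₀∈ , refl =
      ∈-filter⁺ _≢e′? (∈-dartsAt⁺ Γ _ (∈-dartsAt⁻ (delete Γ e′) d₀∈)) (Fin.punchInᵢ≢i e′ e)

  module _ (o : Orientation ne) (φ : Fin ne → ℤ) where

    private
      -- `true` is a default direction for `e′`: with the value 0, either direction gives 0 on both
      -- darts.
      ō : Orientation (suc ne)
      ō = Vector.insertAt o e′ true

      φ̄ : Fin (suc ne) → ℤ
      φ̄ = Vector.insertAt φ e′ 0ℤ

      ψ : Dart (suc ne) → ℤ
      ψ = dartValue ℤ-group ō φ̄

    -- The darts of `e′` carry 0 and drop out of the sum; the remaining ones are the darts of the
    -- smaller graph.
    satisfiesKirchhoff-insertAt : SatisfiesKirchhoff (delete Γ e′) o φ → SatisfiesKirchhoff Γ ō φ̄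
    satisfiesKirchhoff-insertAt kirchhoff v = begin
      Σψ (dartsAt v)                        ≡⟨ product-map-filter _≢e′? ψ ψ-vanishes (dartsAt v) ⟨
      Σψ (filter _≢e′? (dartsAt v))         ≡⟨ product-map-↭ ψ (dartsAt-delete v) ⟩
      Σψ (map embed dartsAt′)               ≡⟨ cong (product ℤ-group) (map-∘ dartsAt′) ⟨
      product ℤ-group (map (ψ ∘ embed) dartsAt′)
                                            ≡⟨ cong (product ℤ-group) (map-cong ψ-embed dartsAt′) ⟩
      product ℤ-group (map (dartValue ℤ-group o φ) dartsAt′)
                                            ≡⟨ kirchhoff v ⟩
      0ℤ                                    ∎
      where
      open ≡-Reasoning
      dartsAt′ = Graph.dartsAt (delete Γ e′) v

      Σψ : List (Dart (suc ne)) → ℤ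
      Σψ = product ℤ-group ∘ map ψ

      ψ-embed : ∀ d → ψ (embed d) ≡ dartValue ℤ-group o φ d
      ψ-embed (e , b) rewrite insertAt-punchIn o e′ true e | insertAt-punchIn φ e′ 0ℤ e = refl

      ψ-vanishes : ∀ d → ¬ (edge d ≢ e′) → ψ d ≡ 0ℤ
      ψ-vanishes (e , b) ¬e≢e′ with e Fin.≟ e′
      ... | no  e≢e′ = contradiction e≢e′ ¬e≢e′
      -- Passing to absolute values hides the inversion in `dartValue`, which avoids a case
      -- distinction on the direction.
      ... | yes refl = ℤ.∣i∣≡0⇒i≡0 (trans (∣dartValue∣ ō φ̄ (e , b)) (cong ∣_∣ (insertAt-lookup φ e′ 0ℤ)))

-- Face signs and twisted flows

·-zero : ∀ s → s · 0ℤ ≡ 0ℤ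
·-zero pos = refl
·-zero neg = refl

∣s·a∣ : ∀ s a → ∣ s · a ∣ ≡ ∣ a ∣
∣s·a∣ pos a = refl
∣s·a∣ neg a = ℤ.∣-i∣≡∣i∣ a

module _ {nv ne} {Γ : Graph nv ne} (π : RotationSystem Γ) where
  open Graph Γ
  open RotationSystem π

  next-injective : Injective _≡_ _≡_ next
  next-injective = Injection.injective (↔⇒↣ rotation)

  faceNext-injective : Injective _≡_ _≡_ faceNext
  faceNext-injective = rev-injective ∘ next-injective

  src-∈-iterate : ∀ {d d′} n → d′ ∈ iterate next d n → src d′ ≡ src d
  src-∈-iterate     (suc n) (here refl) = refl
  src-∈-iterate {d} (suc n) (there d′∈) = trans (src-∈-iterate n d′∈) (src-next d)

  -- Up to the first return to `d` no dart repeats. The list is closed under `next`, so by `cyclic`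
  -- it meets every dart at the vertex.
  rotation-orbit : ∀ d → ∃ λ n → Iterate.iterate next d n ≡ d × iterate next d n ↭ dartsAt (src d)
  rotation-orbit d =
    -- Searching from `next d` instead of `d` excludes the trivial return after zero steps; hence
    -- the length `suc m` below.
    let k , return          = cyclic (next d) d (src-next d)
        m , return′ , d∉    = firstVisit next _≟ᵈ_ (next d) k return
        reach : ∀ {d′} → src d ≡ src d′ → d′ ∈ iterate next d (suc m)
        reach {d′} s =
          let j , nextʲd≡d′ = cyclic d d′ s
          in  subst (_∈ _) nextʲd≡d′ (iterate-∈ next m j return′ (here refl))
    in  suc m , return′ , unique∧set⇒↭
          (unique-iterate next next-injective d m d∉)
          (dartsAt-unique Γ (src d))
          (λ d′∈ → ∈-dartsAt⁺ Γ _ (src-∈-iterate (suc m) d′∈))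
          (λ d′∈ → reach (sym (∈-dartsAt⁻ Γ d′∈)))

  -- The orbit list has `n` entries and permutes `dartsAt (src d)`, which forces `n` to be the
  -- degree.
  next-degree : ∀ d → Iterate.iterate next d (degree (src d)) ≡ d
  next-degree d with rotation-orbit d
  ... | n , return , orbit = subst (λ k → Iterate.iterate next d k ≡ d)
    (trans (sym (length-iterate next d n)) (↭-length orbit)) return

  around-↭-dartsAt : ∀ d → around d ↭ dartsAt (src d)
  around-↭-dartsAt d with rotation-orbit d
  ... | n , return , orbit = subst (λ k → iterate next d k ↭ dartsAt (src d))
    (trans (sym (length-iterate next d n)) (↭-length orbit)) orbit

  -- The orbits of `faceNext` are the boundary walks of the faces, so such an `h` amounts to a
  -- labelling of the faces by signs.
  FaceInvariant : (Dart ne → Sign) → Set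
  FaceInvariant h = ∀ d → h (faceNext d) ≡ h d

  -- The 2-chain witnessing the homology is given by h, the sign of a face being
  -- the common value of h on its darts.
  HomologousMod2 : Rel (List (Dart ne)) 0ℓ
  HomologousMod2 xs ys = ∃ λ h → FaceInvariant h ×
    (∀ d → h d *S h (rev d) ≡ edgeParity (edge d) xs *S edgeParity (edge d) ys)

  -- For transitivity, 2-chains are added by multiplying signs pointwise, and the middle walk `ys`
  -- cancels. The structure is needed to fold over the equivalence closure that defines homotopy.
  homologousMod2-isEquivalence : IsEquivalence HomologousMod2
  homologousMod2-isEquivalence = record
    { refl  = λ {xs} → (λ _ → pos) , (λ _ → refl) , λ d → sym (Sign.s*s≡+ (edgeParity (edge d) xs))
    ; sym   = λ {xs} (h , inv , ∂h) → h , inv , λ d → trans (∂h d) (Sign.*-comm (edgeParity (edge d) xs) _)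
    ; trans = λ {xs} {ys} {zs} (h , inv , ∂h) (k , inv′ , ∂k) →
        (λ d → h d *S k d) , (λ d → cong₂ _*S_ (inv d) (inv′ d)) , λ d → let open ≡-Reasoning in begin
          (h d *S k d) *S (h (rev d) *S k (rev d))  ≡⟨ interchange (h d) _ _ _ ⟩
          (h d *S h (rev d)) *S (k d *S k (rev d))  ≡⟨ cong₂ _*S_ (∂h d) (∂k d) ⟩
          (edgeParity (edge d) xs *S edgeParity (edge d) ys) *S (edgeParity (edge d) ys *S edgeParity (edge d) zs)
                                                    ≡⟨ cancel (edgeParity (edge d) xs) (edgeParity (edge d) ys) _ ⟩
          edgeParity (edge d) xs *S edgeParity (edge d) zs ∎
    }
    where
    cancel : ∀ a b c → (a *S b) *S (b *S c) ≡ a *S c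
    cancel a b c = trans (Sign.*-assoc a b (b *S c)) (cong (a *S_)
      (trans (sym (Sign.*-assoc b b c)) (cong (_*S c) (Sign.s*s≡+ b))))

  -- A spur passes its edge twice and vanishes modulo 2, so the zero chain works. A facial walk is
  -- the boundary of its own face.
  reduces⇒homologousMod2 : ∀ {xs ys} → Reduces xs ys → HomologousMod2 xs ys
  reduces⇒homologousMod2 (spur xs d ys) = (λ _ → pos) , (λ _ → refl) ,
    λ d′ → trans (sym (spur-parity (edge d′))) (edgeParity-remove (edge d′) xs (d ∷ rev d ∷ []) ys)
    where
    spur-parity : ∀ e → edgeParity e (d ∷ rev d ∷ []) ≡ pos
    spur-parity e with does (e Fin.≟ edge d)
    ... | true  = refl
    ... | false = refl
  reduces⇒homologousMod2 (face xs ys (d₀ , k , refl , return , _)) =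
    -- This marks the removed face: `neg` on the darts of `ds`, `pos` on all others.
    (λ d → parity _≟ᵈ_ d ds) ,
    parity-orbit _≟ᵈ_ faceNext-injective d₀ (suc k) return ,
    λ d → trans (sym (edgeParity-darts d ds)) (edgeParity-remove (edge d) xs ds ys)
    where ds = iterate faceNext d₀ (suc k)

  -- A homotopy is a sequence of reductions and their inverses, each preserving the homology class.
  contractible⇒homologousMod2 : ∀ {u C} → Contractible u C → HomologousMod2 C []
  contractible⇒homologousMod2 = EqClosure.fold homologousMod2-isEquivalence
    (λ (_ , _ , red) → reduces⇒homologousMod2 red)

  module _ {h : Dart ne → Sign} (h-face : FaceInvariant h) (ψ : Dart ne → ℤ) where

    twist : Dart ne → 𝔻
    twist d = mk𝔻 (h d *S h (rev d)) (h d · ψ d)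

    -- In the shift of the inverse, `h d` occurs twice and cancels, leaving `h (rev d)` acting on
    -- `- ψ d`.
    twist-rev : (∀ d → ψ (rev d) ≡ - ψ d) → ∀ d → twist (rev d) ≡ twist d ⁻¹𝔻
    twist-rev ψ-rev d rewrite rev-involutive d | ψ-rev d =
      cong₂ mk𝔻 (Sign.*-comm (h (rev d)) (h d)) (shift (h d) (h (rev d)) (ψ d))
      where
      shift : ∀ s t a → t · (- a) ≡ (s *S t) · (- (s · a))
      shift pos t   a = refl
      shift neg pos a = sym (cong -_ (ℤ.neg-involutive a))
      shift neg neg a = refl

    -- Leaving the end of the arc open makes induction possible. The sign of `twist d` converts the
    -- factor `h (next d)` of the later shifts into `h d`, so all shifts add up with one common
    -- sign.
    product-twist : ∀ d n → product 𝔻-group (map twist (iterate next d n)) ≡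
      mk𝔻 (h d *S h (Iterate.iterate next d n)) (h d · product ℤ-group (map ψ (iterate next d n)))
    product-twist d zero    = cong₂ mk𝔻 (sym (Sign.s*s≡+ (h d))) (sym (·-zero (h d)))
    product-twist d (suc n)
      rewrite product-twist (next d) n
            -- Since `next d` is `faceNext (rev d)`, its face sign is `h (rev d)`, the second factor
            -- in the sign of `twist d`.
            | trans (cong (h ∘ next) (sym (rev-involutive d))) (h-face (rev d))
      = step (h d) (h (rev d)) _ (ψ d) _
      where
      step : ∀ s t u a b → mk𝔻 (s *S t) (s · a) ∙𝔻 mk𝔻 (t *S u) (t · b) ≡ mk𝔻 (s *S u) (s · (a +ℤ b))
      step pos pos u   a b = cong (mk𝔻 u) (ℤ.+-comm b a)
      step pos neg pos a b = cong (mk𝔻 pos) (trans (cong (_+ℤ a) (ℤ.neg-involutive b)) (ℤ.+-comm b a))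
      step pos neg neg a b = cong (mk𝔻 neg) (trans (cong (_+ℤ a) (ℤ.neg-involutive b)) (ℤ.+-comm b a))
      step neg pos pos a b = cong (mk𝔻 neg) (trans (ℤ.+-comm (- b) (- a)) (sym (ℤ.neg-distrib-+ a b)))
      step neg pos neg a b = cong (mk𝔻 pos) (trans (ℤ.+-comm (- b) (- a)) (sym (ℤ.neg-distrib-+ a b)))
      step neg neg pos a b = cong (mk𝔻 neg) (trans (ℤ.+-comm (- b) (- a)) (sym (ℤ.neg-distrib-+ a b)))
      step neg neg neg a b = cong (mk𝔻 pos) (trans (ℤ.+-comm (- b) (- a)) (sym (ℤ.neg-distrib-+ a b)))

    twist-isFlow : (∀ d → ψ (rev d) ≡ - ψ d) →
      (∀ v → product ℤ-group (map ψ (dartsAt v)) ≡ 0ℤ) →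
      ∀ o → IsFlow 𝔻-group π o (λ e → twist (e , not (o e)))
    twist-isFlow ψ-rev kirchhoff o d = begin
      product 𝔻-group (map (dartValue 𝔻-group o (λ e → twist (e , not (o e)))) (around d))
        ≡⟨ cong (product 𝔻-group) (map-cong (dartValue-fromDarts 𝔻-group o twist (twist-rev ψ-rev)) (around d)) ⟩
      product 𝔻-group (map twist (around d))
        ≡⟨ product-twist d (degree (src d)) ⟩
      mk𝔻 (h d *S h (Iterate.iterate next d (degree (src d)))) (h d · product ℤ-group (map ψ (around d)))
        -- After a full turn the end of the arc is `d` again, so the two face signs cancel, and the
        -- shift is Kirchhoff's sum at `src d` up to sign.
        ≡⟨ cong₂ mk𝔻 (trans (cong (λ d′ → h d *S h d′) (next-degree d)) (Sign.s*s≡+ (h d)))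
                     (trans (cong (h d ·_) (trans (product-map-↭ ψ (around-↭-dartsAt d)) (kirchhoff (src d))))
                            (·-zero (h d))) ⟩
      1𝔻 ∎
      where open ≡-Reasoning

-- Assembling the dihedral flow

theorem4p7 : ∀ {nv ne} (n : ℕ) → 3 ≤ n →
    (Γ : Graph nv ne) → Graph.Connected Γ → Graph.Cubic Γ →
    (e′ : Fin ne) → HasNowhereZeroFlow n (delete Γ e′) →
    (π : RotationSystem Γ) → RotationSystem.OnSimpleContractibleCycle π e′ →
    (o : Orientation ne) → HasNowhereIdentityDihedralFlow n π o
theorem4p7 {ne = suc ne} n 3≤n Γ _ _ e′ (o₀ , φ , kirchhoff , φ-nowhereZero) π (_ , C , simple , contractible , e′∈C) o
  with contractible⇒homologousMod2 π contractible
... | h , h-face , ∂h≡C = f , isFlow , nowhereIdentity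
  where
  ō : Orientation (suc ne)
  ō = Vector.insertAt o₀ e′ true

  φ̄ : Fin (suc ne) → ℤ
  φ̄ = Vector.insertAt φ e′ 0ℤ

  ψ : Dart (suc ne) → ℤ
  ψ = dartValue ℤ-group ō φ̄

  f : Fin (suc ne) → 𝔻
  f e = twist π h-face ψ (e , not (o e))

  isFlow : IsFlow 𝔻-group π o f
  isFlow = twist-isFlow π h-face ψ (dartValue-rev ℤ-group ō φ̄)
             (satisfiesKirchhoff-insertAt Γ e′ o₀ φ kirchhoff) o

  ∣shift∣ : ∀ e → ∣ 𝔻.shift (f e) ∣ ≡ ∣ φ̄ e ∣
  ∣shift∣ e = trans (∣s·a∣ (h (e , not (o e))) _) (∣dartValue∣ ō φ̄ (e , not (o e)))

  sign-e′ : 𝔻.sign (f e′) ≡ neg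
  -- `C` passes `e′` exactly once because its edges are distinct, and the empty walk contributes
  -- `pos`.
  sign-e′ = trans (∂h≡C (e′ , not (o e′))) (trans (Sign.*-identityʳ _)
    (∈∧unique⇒parity≡neg Fin._≟_ e′∈C (Graph.IsSimpleCycle.distinctEdges simple)))

  nowhereIdentity : ∀ e → f e ≢ 1𝔻 × ∣ 𝔻.shift (f e) ∣ < n
  nowhereIdentity e with e Fin.≟ e′
  -- On `e′` the shift is 0, so the reflection sign alone keeps the value away from the identity.
  ... | yes refl =
    (λ fe≡1 → case trans (sym sign-e′) (cong 𝔻.sign fe≡1) of λ ()) ,
    subst (_< n) (sym (trans (∣shift∣ e) (cong ∣_∣ (insertAt-lookup φ e′ 0ℤ)))) (ℕ.≤-trans (s≤s z≤n) 3≤n)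
  -- Elsewhere the shift is the given flow value up to sign, hence nonzero and below `n` in absolute
  -- value, whether or not the edge lies on `C`.
  ... | no e≢e′ =
    (λ fe≡1 → proj₁ (φ-nowhereZero j)
      (ℤ.∣i∣≡0⇒i≡0 (trans (sym ∣shift∣≡∣φ∣) (cong (∣_∣ ∘ 𝔻.shift) fe≡1)))) ,
    subst (_< n) (sym ∣shift∣≡∣φ∣) (proj₂ (φ-nowhereZero j))
    where
    j : Fin ne
    j = punchOut (e≢e′ ∘ sym)

    ∣shift∣≡∣φ∣ : ∣ 𝔻.shift (f e) ∣ ≡ ∣ φ j ∣
    ∣shift∣≡∣φ∣ = trans (∣shift∣ e) (cong ∣_∣ (trans
      (cong φ̄ (sym (Fin.punchIn-punchOut (e≢e′ ∘ sym))))
      (insertAt-punchIn φ e′ 0ℤ j)))
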